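{- Let $P$ be a poset (possibly infinite) whose underlying set is the union of two chains, and suppose that its incomparability graph $\mathrm{Inc}(P)$ is connected. Then the following properties are equivalent: (i) $\mathrm{Inc}(P)$ contains, as an induced subgraph, a direct sum of finite paths of arbitrarily large length (i.e. a direct sum $\bigoplus_n Q_n$ of finite paths $Q_n$ whose lengths are unbounded); (ii) the detour of $\mathrm{Inc}(P)$ is infinite, i.e. $\mathrm{Inc}(P)$ has induced finite paths of arbitrarily large length; (iii) the diameter of $\mathrm{Inc}(P)$ is infinite; (iv) $\mathrm{Inc}(P)$ contains an infinite induced path.
   Context: Graphs are undirected, simple, loopless, possibly infinite. For a poset $P=(V,\le)$, the incomparability graph $\mathrm{Inc}(P)$ has vertex set $V$ and edges the pairs $\{u,v\}$ of incomparable elements. A chain is a totally ordered subset. A path is a graph whose vertices can be injectively mapped by $f$ onto an interval of $\mathbb N$ so that $\{u,v\}$ is an edge iff $|f(u)-f(v)|=1$; a finite path on $n$ vertices has length $n-1$; the (one way) infinite path has vertices indexed by $\mathbb N$. An induced path of $G$ is an induced subgraph of $G$ that is a path. The direct sum of a family of graphs with pairwise disjoint vertex sets is their disjoint union (no edges between distinct members). The distance $d_G(x,y)$ is the length of a shortest path from $x$ to $y$ ($\infty$ if none), and the diameter of $G$ is $\sup\{d_G(x,y):x,y\in V(G)\}$. The detour of $G$ is the supremum of the lengths of the finite induced paths of $G$. -}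

module Defs where

open import Level using (Level; _⊔_; suc; 0ℓ)
open import Data.Fin.Base using (Fin; zero; fromℕ; toℕ)
open import Data.Nat.Base as ℕ using (ℕ; ∣_-_∣)
open import Data.Nat.Properties using (∣-∣-comm; ∣n-n∣≡0)
open import Data.Product.Base using (Σ; Σ-syntax; ∃-syntax; _×_; _,_; proj₁; proj₂; swap)
open import Data.Sum.Base using (_⊎_)
open import Relation.Binary.Bundles using (Setoid; Poset)
open import Relation.Binary.Core using (Rel)
open import Relation.Binary.Construct.Add.Supremum.NonStrict ℕ._≤_ using (_≤⁺_)
open import Relation.Binary.Definitions using (Symmetric; _Respects₂_)
open import Relation.Binary.PropositionalEquality.Core using (_≡_; refl; sym; trans)
import Relation.Binary.PropositionalEquality.Properties as ≡
open import Relation.Nullary.Construct.Add.Supremum using (_⁺; [_]; ⊤⁺)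
open import Relation.Nullary.Negation.Core using (¬_)
open import Relation.Unary using (Pred; _∈_)

private
  variable
    a b c e i ℓ c₁ ℓ₁ e₁ c₂ ℓ₂ e₂ : Level

-- Simple, undirected, loopless; vertices form a setoid because the
-- elements of a `Poset` do.
record Graph c ℓ e : Set (suc (c ⊔ ℓ ⊔ e)) where
  field
    vertices : Setoid c ℓ

  open Setoid vertices public using (_≈_) renaming (Carrier to V)

  field
    Adj      : Rel V e
    Adj-resp : Adj Respects₂ _≈_
    Adj-sym  : Symmetric Adj
    loopless : ∀ {x y} → x ≈ y → ¬ Adj x y

-- An isomorphism from H onto a, not necessarily induced, subgraph of G.
record SubgraphEmbedding (H : Graph c₁ ℓ₁ e₁) (G : Graph c₂ ℓ₂ e₂)
       : Set (c₁ ⊔ ℓ₁ ⊔ e₁ ⊔ c₂ ⊔ ℓ₂ ⊔ e₂) where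
  private
    module H = Graph H
    module G = Graph G
  field
    to        : H.V → G.V
    cong      : ∀ {x y} → x H.≈ y → to x G.≈ to y
    injective : ∀ {x y} → to x G.≈ to y → x H.≈ y
    preserves : ∀ {x y} → H.Adj x y → G.Adj (to x) (to y)

-- An isomorphism from H onto an induced subgraph of G.
record InducedEmbedding (H : Graph c₁ ℓ₁ e₁) (G : Graph c₂ ℓ₂ e₂)
       : Set (c₁ ⊔ ℓ₁ ⊔ e₁ ⊔ c₂ ⊔ ℓ₂ ⊔ e₂) where
  private
    module H = Graph H
    module G = Graph G
  field
    subgraphEmbedding : SubgraphEmbedding H G

  open SubgraphEmbedding subgraphEmbedding public

  field
    reflects : ∀ {x y} → G.Adj (to x) (to y) → H.Adj x y

private
  ∣-∣≡1-sym : ∀ m n → ∣ m - n ∣ ≡ 1 → ∣ n - m ∣ ≡ 1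
  ∣-∣≡1-sym m n p = trans (∣-∣-comm n m) p

  ∣-∣≡1-irrefl : ∀ n → ¬ ∣ n - n ∣ ≡ 1
  ∣-∣≡1-irrefl n p with trans (sym (∣n-n∣≡0 n)) p
  ... | ()

-- The path of length n, which has n + 1 vertices.
FinitePath : ℕ → Graph 0ℓ 0ℓ 0ℓ
FinitePath n = record
  { vertices = ≡.setoid (Fin (ℕ.suc n))
  ; Adj      = λ x y → ∣ toℕ x - toℕ y ∣ ≡ 1
  ; Adj-resp = (λ { refl p → p }) , (λ { refl p → p })
  ; Adj-sym  = λ {x} {y} → ∣-∣≡1-sym (toℕ x) (toℕ y)
  ; loopless = λ { {x} refl → ∣-∣≡1-irrefl (toℕ x) }
  }

InfinitePath : Graph 0ℓ 0ℓ 0ℓ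
InfinitePath = record
  { vertices = ≡.setoid ℕ
  ; Adj      = λ x y → ∣ x - y ∣ ≡ 1
  ; Adj-resp = (λ { refl p → p }) , (λ { refl p → p })
  ; Adj-sym  = λ {x} {y} → ∣-∣≡1-sym x y
  ; loopless = λ { {x} refl → ∣-∣≡1-irrefl x }
  }

-- Relates (i , x) to (j , y) when i is j and R i relates x to y.
data SumRel {I : Set i} {A : I → Set a} (R : ∀ i → Rel (A i) b)
            : Rel (Σ I A) (i ⊔ a ⊔ b) where
  within : ∀ {i} {x y : A i} → R i x y → SumRel R (i , x) (i , y)

⨁ : {I : Set i} → (I → Graph c ℓ e) → Graph (i ⊔ c) (i ⊔ c ⊔ ℓ) (i ⊔ c ⊔ e)
⨁ {I = I} G = record
  { vertices = record
    { Carrier       = Σ I (λ i → Graph.V (G i))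
    ; _≈_           = SumRel (λ i → Graph._≈_ (G i))
    ; isEquivalence = record
      { refl  = λ { {i , _} → within (Setoid.refl (Graph.vertices (G i))) }
      ; sym   = λ { (within {i} p) → within (Setoid.sym (Graph.vertices (G i)) p) }
      ; trans = λ { (within {i} p) (within q) →
                    within (Setoid.trans (Graph.vertices (G i)) p q) }
      }
    }
  ; Adj      = SumRel (λ i → Graph.Adj (G i))
  ; Adj-resp = (λ { (within {i} p) (within q) → within (proj₁ (Graph.Adj-resp (G i)) p q) })
             , (λ { (within {i} p) (within q) → within (proj₂ (Graph.Adj-resp (G i)) p q) })
  ; Adj-sym  = λ { (within {i} p) → within (Graph.Adj-sym (G i) p) }
  ; loopless = λ { (within {i} p) (within q) → Graph.loopless (G i) p q }
  }

-- Extended naturals are ℕ ⁺, with ⊤⁺ playing the role of ∞.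
IsSupremum : Pred (ℕ ⁺) a → ℕ ⁺ → Set a
IsSupremum S s = (∀ d → d ∈ S → d ≤⁺ s) × (∀ u → (∀ d → d ∈ S → d ≤⁺ u) → s ≤⁺ u)

module _ (G : Graph c ℓ e) where
  open Graph G

  record PathBetween (x y : V) (n : ℕ) : Set (c ⊔ ℓ ⊔ e) where
    field
      path   : SubgraphEmbedding (FinitePath n) G

    open SubgraphEmbedding path public

    field
      source : to zero ≈ x
      target : to (fromℕ n) ≈ y

  Connected : Set (c ⊔ ℓ ⊔ e)
  Connected = ∀ x y → ∃[ n ] PathBetween x y n

  IsDistance : V → V → Pred (ℕ ⁺) (c ⊔ ℓ ⊔ e)
  IsDistance x y [ d ] = PathBetween x y d × (∀ n → PathBetween x y n → d ℕ.≤ n)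
  IsDistance x y ⊤⁺    = ∀ n → ¬ PathBetween x y n

  IsDiameter : Pred (ℕ ⁺) (c ⊔ ℓ ⊔ e)
  IsDiameter = IsSupremum (λ d → ∃[ x ] ∃[ y ] IsDistance x y d)

  IsDetour : Pred (ℕ ⁺) (c ⊔ ℓ ⊔ e)
  IsDetour = IsSupremum (λ d → ∃[ n ] d ≡ [ n ] × InducedEmbedding (FinitePath n) G)

  InfiniteDiameter : Set (c ⊔ ℓ ⊔ e)
  InfiniteDiameter = IsDiameter ⊤⁺

  InfiniteDetour : Set (c ⊔ ℓ ⊔ e)
  InfiniteDetour = IsDetour ⊤⁺

  ContainsInfiniteInducedPath : Set (c ⊔ ℓ ⊔ e)
  ContainsInfiniteInducedPath = InducedEmbedding InfinitePath G

  ContainsSumOfUnboundedPaths : Set (c ⊔ ℓ ⊔ e)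
  ContainsSumOfUnboundedPaths =
    Σ[ len ∈ (ℕ → ℕ) ] (∀ m → ∃[ n ] m ℕ.≤ len n)
           × InducedEmbedding (⨁ {I = ℕ} (λ n → FinitePath (len n))) G

module _ (P : Poset c ℓ₁ ℓ₂) where
  open Poset P

  Incomparable : Rel Carrier ℓ₂
  Incomparable x y = ¬ (x ≤ y) × ¬ (y ≤ x)

  Inc : Graph c ℓ₁ ℓ₂
  Inc = record
    { vertices = record { isEquivalence = isEquivalence }
    ; Adj      = Incomparable
    ; Adj-resp = (λ y≈z (x≰y , y≰x) → (λ x≤z → x≰y (≤-respʳ-≈ (Eq.sym y≈z) x≤z))
                                    , (λ z≤x → y≰x (≤-respˡ-≈ (Eq.sym y≈z) z≤x)))
               , (λ y≈z (y≰x , x≰y) → (λ z≤x → y≰x (≤-respˡ-≈ (Eq.sym y≈z) z≤x))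
                                    , (λ x≤z → x≰y (≤-respʳ-≈ (Eq.sym y≈z) x≤z)))
    ; Adj-sym  = swap
    ; loopless = λ x≈y (x≰y , _) → x≰y (reflexive x≈y)
    }

  IsChain : Pred Carrier a → Set (c ⊔ ℓ₂ ⊔ a)
  IsChain C = ∀ {x y} → x ∈ C → y ∈ C → x ≤ y ⊎ y ≤ x

{-# OPTIONS --safe #-}

-- Call G the incomparability graph of an order ⊑. A walk from below z to a vertex not below z
-- passes next to z. So if the vertices above o are unboundedly far from o, one can climb through
-- ever farther vertices by pieces of geodesics, giving an infinite walk along which the distance to o
-- tends to infinity; jumping repeatedly to the last neighbour along the walk makes it an induced path.
-- Conversely an induced path of a triangle-free G increases with its index, and every edge of G
-- changes the position along it by at most 3, so its ends are far apart.
module Submission where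

open import Level using (Level; _⊔_)
open import Axiom.ExcludedMiddle using (ExcludedMiddle)
open import Data.Fin.Base using (Fin; zero; suc; fromℕ; fromℕ<; inject₁; toℕ)
open import Data.Fin.Properties using (toℕ-fromℕ<; toℕ-inject₁; toℕ-injective; toℕ<n; toℕ≤pred[n])
open import Data.Nat.Base as ℕ
  using (ℕ; zero; suc; _+_; _*_; _∸_; _≤_; _<_; z≤n; s≤s; s≤s⁻¹; ∣_-_∣)
open import Data.Nat.Properties
open import Data.Product.Base using (Σ; Σ-syntax; ∃-syntax; _×_; _,_; proj₁; proj₂; map₂)
open import Data.Sum.Base as Sum using (_⊎_; inj₁; inj₂; [_,_]′)
open import Function.Base using (id; _∘_; flip)
open import Function.Bundles using (_⇔_; mk⇔)
open import Relation.Binary.Bundles using (Poset; Setoid)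
open import Relation.Binary.Construct.Add.Supremum.NonStrict ℕ._≤_ using (_≤⁺_; [_]; _≤⊤⁺)
import Relation.Binary.Construct.Flip.EqAndOrd as Flip
open import Relation.Binary.Construct.Closure.ReflexiveTransitive using (Star; ε; _◅_)
open import Relation.Binary.Core using (Rel)
open import Relation.Binary.Definitions using (tri<; tri≈; tri>)
open import Relation.Binary.PropositionalEquality.Core using (_≡_; refl; sym; trans; cong; cong₂; subst)
open import Relation.Binary.Structures using (IsPartialOrder)
open import Relation.Nullary.Construct.Add.Supremum using (_⁺; [_]; ⊤⁺)
open import Relation.Nullary.Decidable using (Dec; yes; no; decidable-stable)
open import Relation.Nullary.Negation using (¬_; contradiction)
open import Relation.Unary using (Pred; _∈_)
open import Defs

private
  variable
    a b c e ℓ p r c₁ ℓ₁ e₁ c₂ ℓ₂ e₂ c₃ ℓ₃ e₃ : Level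
    k m n : ℕ

-- Extremal witnesses in `ℕ` and infinite suprema in `ℕ ⁺`.

∣n-1+n∣≡1 : ∀ n → ∣ n - suc n ∣ ≡ 1
∣n-1+n∣≡1 zero    = refl
∣n-1+n∣≡1 (suc n) = ∣n-1+n∣≡1 n

∣m-n∣≡1⇒consecutive : ∀ m n → ∣ m - n ∣ ≡ 1 → n ≡ suc m ⊎ m ≡ suc n
∣m-n∣≡1⇒consecutive zero    n       p    = inj₁ p
∣m-n∣≡1⇒consecutive (suc m) zero    p    = inj₂ p
∣m-n∣≡1⇒consecutive (suc m) (suc n) p    = Sum.map (cong suc) (cong suc) (∣m-n∣≡1⇒consecutive m n p)

module _ {P : Pred ℕ p} (P? : ∀ n → Dec (P n)) where

  least : ∀ {n} → P n → ∃[ m ] P m × (∀ k → P k → m ≤ k)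
  least {n} Pn = go n 0 (n , Pn , +-identityʳ n) (λ _ _ → z≤n)
    where
    -- `fuel` is the distance from the candidate `m` up to a known witness, so the upward search
    -- stops there at the latest.
    go : ∀ fuel m → (∃[ n ] P n × fuel + m ≡ n) → (∀ k → P k → m ≤ k) →
         ∃[ m ] P m × (∀ k → P k → m ≤ k)
    go fuel m _ m≤ with P? m
    go fuel       m _              m≤ | yes Pm = m , Pm , m≤
    go zero       m (_ , Pn , refl) m≤ | no ¬Pm = contradiction Pn ¬Pm
    go (suc fuel) m (n , Pn , eq)   m≤ | no ¬Pm =
      go fuel (suc m) (n , Pn , trans (+-suc fuel m) eq)
        (λ k Pk → ≤∧≢⇒< (m≤ k Pk) λ { refl → ¬Pm Pk })

  greatest : ∀ {n} → P n → ∀ N → (∀ k → P k → k < N) → ∃[ m ] P m × (∀ k → P k → k ≤ m)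
  greatest Pn zero    <N = contradiction (<N _ Pn) λ ()
  greatest Pn (suc N) <N with P? N
  ... | yes PN = N , PN , λ k Pk → s≤s⁻¹ (<N k Pk)
  ... | no ¬PN = greatest Pn N λ k Pk → ≤∧≢⇒< (s≤s⁻¹ (<N k Pk)) λ { refl → ¬PN Pk }

unbounded⇒supremum-⊤⁺ : {S : Pred (ℕ ⁺) a} →
  (∀ k → ∃[ d ] d ∈ S × ¬ (d ≤⁺ [ k ])) → IsSupremum S ⊤⁺
unbounded⇒supremum-⊤⁺ {S = S} unb = (λ d _ → d ≤⊤⁺) , top
  where
  top : ∀ u → (∀ d → d ∈ S → d ≤⁺ u) → ⊤⁺ ≤⁺ u
  top ⊤⁺    _  = ⊤⁺ ≤⊤⁺
  top [ k ] S≤ = let d , d∈S , d≰ = unb k in contradiction (S≤ d d∈S) d≰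

-- If nothing in `S` exceeded `k`, then `[ k ]` would be an upper bound smaller than `⊤⁺`.
supremum-⊤⁺⇒unbounded : (∀ {ℓ} → ExcludedMiddle ℓ) → {S : Pred (ℕ ⁺) a} →
  IsSupremum S ⊤⁺ → ∀ k → ∃[ d ] d ∈ S × ¬ (d ≤⁺ [ k ])
supremum-⊤⁺⇒unbounded em (_ , top) k = decidable-stable em λ none →
  contradiction (top [ k ] λ d d∈S → decidable-stable em λ d≰ → none (d , d∈S , d≰)) λ ()

-- Induced embeddings, and finite paths laid out along the infinite path.

_∘ᵉ_ : {F : Graph c₁ ℓ₁ e₁} {G : Graph c₂ ℓ₂ e₂} {H : Graph c₃ ℓ₃ e₃} →
       InducedEmbedding G H → InducedEmbedding F G → InducedEmbedding F H
g ∘ᵉ f = record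
  { subgraphEmbedding = record
    { to        = g.to ∘ f.to
    ; cong      = g.cong ∘ f.cong
    ; injective = f.injective ∘ g.injective
    ; preserves = g.preserves ∘ f.preserves
    }
  ; reflects = f.reflects ∘ g.reflects
  }
  where
  module g = InducedEmbedding g
  module f = InducedEmbedding f

blockStart : ℕ → ℕ
blockStart zero    = 0
blockStart (suc n) = blockStart n + (2 + n)

blockStart-gap : ∀ {m n} → m < n → blockStart m + (2 + m) ≤ blockStart n
blockStart-gap {m} {suc n} (s≤s m≤n) with m≤n⇒m<n∨m≡n m≤n
... | inj₁ m<n  = ≤-trans (blockStart-gap m<n) (m≤m+n _ _)
... | inj₂ refl = ≤-refl

blocks : InducedEmbedding (⨁ FinitePath) InfinitePath
blocks = record
  { subgraphEmbedding = record
    { to        = at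
    ; cong      = λ { (within refl) → refl }
    ; injective = injective
    ; preserves = λ { (within {n} {x} {y} x~y) →
                      trans (∣m+n-m+o∣≡∣n-o∣ (blockStart n) (toℕ x) (toℕ y)) x~y }
    }
  ; reflects = reflects
  }
  where
  at : Σ ℕ (Fin ∘ suc) → ℕ
  at (n , x) = blockStart n + toℕ x

  separated : ∀ {m n} x y → m < n → suc (at (m , x)) < at (n , y)
  separated {m} {n} x y m<n = begin
    2 + at (m , x)               ≡⟨ cong suc (+-suc (blockStart m) (toℕ x)) ⟨
    suc (blockStart m + suc (toℕ x)) ≡⟨ +-suc (blockStart m) (suc (toℕ x)) ⟨
    blockStart m + (2 + toℕ x)   ≤⟨ +-monoʳ-≤ (blockStart m) (s≤s (toℕ<n x)) ⟩
    blockStart m + (2 + m)       ≤⟨ blockStart-gap m<n ⟩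
    blockStart n                 ≤⟨ m≤m+n _ _ ⟩
    at (n , y)                   ∎
    where open ≤-Reasoning

  injective : ∀ {u v} → at u ≡ at v → SumRel (λ _ → _≡_) u v
  injective {m , x} {n , y} eq with <-cmp m n
  ... | tri< m<n _ _  = contradiction eq (<⇒≢ (<-trans (n<1+n _) (separated x y m<n)))
  ... | tri> _ _ n<m  = contradiction (sym eq) (<⇒≢ (<-trans (n<1+n _) (separated y x n<m)))
  ... | tri≈ _ refl _ = within (toℕ-injective (+-cancelˡ-≡ (blockStart m) _ _ eq))

  notBelow : ∀ {A : Set} {i j} → i ≡ suc j → suc i < j → A
  notBelow refl i<j = contradiction (≤-trans (m≤n+m _ 2) i<j) 1+n≰n

  reflects : ∀ {u v} → ∣ at u - at v ∣ ≡ 1 → SumRel (λ n → Graph.Adj (FinitePath n)) u v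
  reflects {m , x} {n , y} eq with <-cmp m n | ∣m-n∣≡1⇒consecutive (at (m , x)) (at (n , y)) eq
  ... | tri< m<n _ _  | inj₁ next = contradiction (sym next) (<⇒≢ (separated x y m<n))
  ... | tri< m<n _ _  | inj₂ next = notBelow next (separated x y m<n)
  ... | tri> _ _ n<m  | inj₁ next = notBelow next (separated y x n<m)
  ... | tri> _ _ n<m  | inj₂ next = contradiction (sym next) (<⇒≢ (separated y x n<m))
  ... | tri≈ _ refl _ | _ = within (trans (sym (∣m+n-m+o∣≡∣n-o∣ (blockStart m) (toℕ x) (toℕ y))) eq)

-- Walks, geodesics and distances.

module Walks (G : Graph c ℓ e) where
  open Graph G
  private module Eq = Setoid vertices

  -- Vertices may repeat, so walks concatenate freely; `nil` carries an equivalence because vertices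
  -- form a setoid.
  data Walk : V → V → ℕ → Set (c ⊔ ℓ ⊔ e) where
    nil  : ∀ {x y} → x ≈ y → Walk x y 0
    cons : ∀ {x y z n} → Adj x y → Walk y z n → Walk x z (suc n)

  walk-respˡ : ∀ {x y z} → x ≈ y → Walk y z n → Walk x z n
  walk-respˡ x≈y (nil y≈z)    = nil (Eq.trans x≈y y≈z)
  walk-respˡ x≈y (cons y~u w) = cons (proj₂ Adj-resp (Eq.sym x≈y) y~u) w

  walk-respʳ : ∀ {x y z} → y ≈ z → Walk x y n → Walk x z n
  walk-respʳ y≈z (nil x≈y)    = nil (Eq.trans x≈y y≈z)
  walk-respʳ y≈z (cons x~u w) = cons x~u (walk-respʳ y≈z w)

  _++_ : ∀ {x y z} → Walk x y m → Walk y z n → Walk x z (m + n)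
  nil x≈y    ++ w′ = walk-respˡ x≈y w′
  cons x~u w ++ w′ = cons x~u (w ++ w′)

  snoc : ∀ {x y z} → Walk x y n → Adj y z → Walk x z (suc n)
  snoc (nil x≈y)    y~z = cons (proj₂ Adj-resp (Eq.sym x≈y) y~z) (nil Eq.refl)
  snoc (cons x~u w) y~z = cons x~u (snoc w y~z)

  reverse : ∀ {x y} → Walk x y n → Walk y x n
  reverse (nil x≈y)    = nil (Eq.sym x≈y)
  reverse (cons x~u w) = snoc (reverse w) (Adj-sym x~u)

  path⇒walk : ∀ {x y} → PathBetween G x y n → Walk x y n
  path⇒walk {n} π = walk-respˡ (Eq.sym source) (walk-respʳ target
    (go n to λ i → preserves (trans (cong ∣_- suc (toℕ i) ∣ (toℕ-inject₁ i)) (∣n-1+n∣≡1 (toℕ i)))))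
    where
    open PathBetween π using (to; preserves; source; target)
    go : ∀ n (f : Fin (suc n) → V) → (∀ i → Adj (f (inject₁ i)) (f (suc i))) →
         Walk (f zero) (f (fromℕ n)) n
    go zero    f f~ = nil Eq.refl
    go (suc n) f f~ = cons (f~ zero) (go n (f ∘ suc) (f~ ∘ suc))

  at : ∀ {x y} → Walk x y n → Fin (suc n) → V
  at {x = x} w zero     = x
  at (cons _ w) (suc i) = at w i

  take : ∀ {x y} (w : Walk x y n) i → Walk x (at w i) (toℕ i)
  take w            zero    = nil Eq.refl
  take (cons x~u w) (suc i) = cons x~u (take w i)

  drop : ∀ {x y} (w : Walk x y n) i → Walk (at w i) y (n ∸ toℕ i)
  drop w          zero    = w
  drop (cons _ w) (suc i) = drop w i

  at-last : ∀ {x y} (w : Walk x y n) → at w (fromℕ n) ≈ y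
  at-last (nil x≈y)  = x≈y
  at-last (cons _ w) = at-last w

  at-adj : ∀ {x y} (w : Walk x y n) i j → toℕ j ≡ suc (toℕ i) → Adj (at w i) (at w j)
  at-adj (cons x~u w)          zero    (suc zero) _  = x~u
  at-adj (cons x~u (cons _ _)) zero    (suc (suc _)) ()
  at-adj (cons _ w)            (suc i) (suc j) eq = at-adj w i j (suc-injective eq)

  -- A repeated vertex would allow the part between its two occurrences to be cut out, giving a
  -- shorter walk.
  shortest⇒path : ∀ {x y} → Walk x y n → (∀ m → Walk x y m → n ≤ m) → PathBetween G x y n
  shortest⇒path {n} {x} {y} w n≤ = record
    { path = record
      { to        = at w
      ; cong      = λ { refl → Eq.refl }
      ; injective = λ {i} {j} → injective i j
      ; preserves = λ {i} {j} i~j → [ at-adj w i j , Adj-sym ∘ at-adj w j i ]′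
                                      (∣m-n∣≡1⇒consecutive (toℕ i) (toℕ j) i~j)
      }
    ; source = Eq.refl
    ; target = at-last w
    }
    where
    no-repeat : ∀ i j → toℕ i < toℕ j → ¬ at w i ≈ at w j
    no-repeat i j i<j eq = <-irrefl refl (begin-strict
      n                      ≤⟨ n≤ _ (take w i ++ walk-respˡ eq (drop w j)) ⟩
      toℕ i + (n ∸ toℕ j)    <⟨ +-monoˡ-< (n ∸ toℕ j) i<j ⟩
      toℕ j + (n ∸ toℕ j)    ≡⟨ m+[n∸m]≡n (toℕ≤pred[n] j) ⟩
      n                      ∎)
      where open ≤-Reasoning

    injective : ∀ i j → at w i ≈ at w j → i ≡ j
    injective i j eq with <-cmp (toℕ i) (toℕ j)
    ... | tri< i<j _ _ = contradiction eq (no-repeat i j i<j)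
    ... | tri≈ _ i≡j _ = toℕ-injective i≡j
    ... | tri> _ _ j<i = contradiction (Eq.sym eq) (no-repeat j i j<i)

  -- An induced path of length `n`, indexed by all of `ℕ` to avoid arithmetic in `Fin`; only indices
  -- up to `n` are constrained.
  InducedSequence : ℕ → (ℕ → V) → Set (ℓ ⊔ e)
  InducedSequence n x = (∀ {i} → suc i ≤ n → Adj (x i) (x (suc i))) ×
                        (∀ {i j} → suc i < j → j ≤ n → ¬ x i ≈ x j × ¬ Adj (x i) (x j))

  Far : V → ℕ → V → Set (c ⊔ ℓ ⊔ e)
  Far o k z = ∀ n → Walk o z n → k ≤ n

  far-weaken : ∀ {o z} → m ≤ n → Far o n z → Far o m z
  far-weaken m≤n far k w = ≤-trans m≤n (far k w)

  -- This is the triangle inequality.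
  far-prefix : ∀ {o u z} i j → Walk u z j → Far o (i + j) z → Far o i u
  far-prefix i j w far n w′ = +-cancelʳ-≤ j i n (far (n + j) (w′ ++ w))

  -- Each `W i` has a last neighbour along `W`. Jumping to it every time leaves no adjacency between
  -- selected vertices that are not consecutive.
  locallyFinite⇒inducedPath : (∀ {ℓ} → ExcludedMiddle ℓ) → (W : ℕ → V) →
    (∀ i → Adj (W i) (W (suc i))) → (∀ i → ∃[ N ] (∀ j → Adj (W i) (W j) → j < N)) →
    ContainsInfiniteInducedPath G
  locallyFinite⇒inducedPath em W W-adj finite = record
    { subgraphEmbedding = record
      { to        = W ∘ idx
      ; cong      = λ { refl → Eq.refl }
      ; injective = λ {i} {j} → injective i j
      ; preserves = λ {i} {j} i~j → [ (λ { refl → adj-last i }) , (λ { refl → Adj-sym (adj-last j) }) ]′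
                                      (∣m-n∣≡1⇒consecutive i j i~j)
      }
    ; reflects = λ {i} {j} → reflects i j
    }
    where
    lastNeighbour : ∀ i → ∃[ j ] Adj (W i) (W j) × (∀ k → Adj (W i) (W k) → k ≤ j)
    lastNeighbour i = let N , <N = finite i in greatest (λ _ → em) (W-adj i) N <N

    last : ℕ → ℕ
    last i = proj₁ (lastNeighbour i)

    idx : ℕ → ℕ
    idx zero    = 0
    idx (suc i) = last (idx i)

    adj-last : ∀ i → Adj (W (idx i)) (W (idx (suc i)))
    adj-last i = proj₁ (proj₂ (lastNeighbour (idx i)))

    neighbour≤ : ∀ i j → Adj (W (idx i)) (W (idx j)) → idx j ≤ idx (suc i)
    neighbour≤ i j = proj₂ (proj₂ (lastNeighbour (idx i))) (idx j)

    idx-mono : ∀ {i j} → i < j → idx i < idx j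
    idx-mono {i} {suc j} (s≤s i≤j) with m≤n⇒m<n∨m≡n i≤j
    ... | inj₁ i<j  = <-trans (idx-mono i<j) (proj₂ (proj₂ (lastNeighbour (idx j))) _ (W-adj (idx j)))
    ... | inj₂ refl = proj₂ (proj₂ (lastNeighbour (idx j))) _ (W-adj (idx j))

    idx-cancel-≤ : ∀ {i j} → idx i ≤ idx j → i ≤ j
    idx-cancel-≤ idx≤ = ≮⇒≥ λ j<i → <⇒≱ (idx-mono j<i) idx≤

    no-repeat : ∀ i j → i < j → ¬ W (idx i) ≈ W (idx j)
    -- If the two vertices agreed, the earlier one would be adjacent to the successor of the later
    -- one, beyond its own last neighbour.
    no-repeat i j i<j eq = <⇒≱ i<j
      (s≤s⁻¹ (idx-cancel-≤ (neighbour≤ i (suc j) (proj₂ Adj-resp (Eq.sym eq) (adj-last j)))))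

    injective : ∀ i j → W (idx i) ≈ W (idx j) → i ≡ j
    injective i j eq with <-cmp i j
    ... | tri< i<j _ _ = contradiction eq (no-repeat i j i<j)
    ... | tri≈ _ i≡j _ = i≡j
    ... | tri> _ _ j<i = contradiction (Eq.sym eq) (no-repeat j i j<i)

    adj⇒next : ∀ i j → i < j → Adj (W (idx i)) (W (idx j)) → j ≡ suc i
    adj⇒next i j i<j i~j = ≤-antisym (idx-cancel-≤ (neighbour≤ i j i~j)) i<j

    reflects : ∀ i j → Adj (W (idx i)) (W (idx j)) → ∣ i - j ∣ ≡ 1
    reflects i j i~j with <-cmp i j
    ... | tri≈ _ refl _ = contradiction i~j (loopless Eq.refl)
    ... | tri< i<j _ _ rewrite adj⇒next i j i<j i~j = ∣n-1+n∣≡1 i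
    ... | tri> _ _ j<i rewrite adj⇒next j i j<i (Adj-sym i~j) = trans (∣-∣-comm (suc j) j) (∣n-1+n∣≡1 j)

-- Incomparability graphs of partial orders.

-- G is the incomparability graph of ⊑.
record Incomparability (G : Graph c ℓ e) (r : Level) : Set (c ⊔ ℓ ⊔ e ⊔ Level.suc r) where
  open Graph G
  infix 4 _⊑_
  field
    _⊑_            : Rel V r
    isPartialOrder : IsPartialOrder _≈_ _⊑_
    adj⇒⋢          : ∀ {x y} → Adj x y → ¬ x ⊑ y
    nonadj⇒⊑⊎⊒     : ∀ {x y} → ¬ Adj x y → x ⊑ y ⊎ y ⊑ x

  module ⊑ = IsPartialOrder isPartialOrder

-- Reversing the order keeps the graph, so each argument about going up also covers going down.
dual : {G : Graph c ℓ e} → Incomparability G r → Incomparability G r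
dual {G = G} O = record
  { _⊑_            = flip _⊑_
  ; isPartialOrder = Flip.isPartialOrder isPartialOrder
  ; adj⇒⋢          = adj⇒⋢ ∘ Graph.Adj-sym G
  ; nonadj⇒⊑⊎⊒     = Sum.swap ∘ nonadj⇒⊑⊎⊒
  }
  where open Incomparability O

module IncomparabilityGraph (em : ∀ {ℓ} → ExcludedMiddle ℓ) (G : Graph c ℓ e)
                            (O : Incomparability G r) where
  open Graph G
  open Walks G
  open Incomparability O
  private module Eq = Setoid vertices

  -- A walk from below z to y passes next to z unless it ends below z: it cannot jump over z.
  nextToWalk : ∀ {x y z} → Walk x y n → x ⊑ z →
    y ⊑ z ⊎ Σ[ u ∈ V ] ∃[ i ] ∃[ j ] Walk x u i × Adj u z × Walk u y j × i + j ≡ n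
  nextToWalk (nil x≈y) x⊑z = inj₁ (⊑.≤-respˡ-≈ x≈y x⊑z)
  nextToWalk {z = z} (cons {y = v} x~v w) x⊑z with em {P = Adj v z}
  ... | yes v~z = inj₂ (v , _ , _ , cons x~v (nil Eq.refl) , v~z , w , refl)
  ... | no  v≁z with nonadj⇒⊑⊎⊒ v≁z
  -- Here `z` would lie between the adjacent vertices `x` and `v`, making them comparable.
  ...   | inj₂ z⊑v = contradiction (⊑.trans x⊑z z⊑v) (adj⇒⋢ x~v)
  ...   | inj₁ v⊑z = Sum.map₂
    (λ (u , i , j , w₁ , u~z , w₂ , eq) → u , suc i , j , cons x~v w₁ , u~z , w₂ , cong suc eq)
    (nextToWalk w v⊑z)

  -- An infinite induced path through ever farther vertices above `o`.

  module _ (walk : ∀ x y → ∃[ n ] Walk x y n) (o : V) where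

    FarTrail : ℕ → V → V → Set _
    FarTrail k = Star (λ x y → Adj x y × Far o k y)

    -- A vertex `s` steps along the walk is `j - s` steps from `z`, hence at distance at least
    -- `i + s` from `o`. The end is `z′` because `Star` ends exactly at its index while a walk ends
    -- up to `≈`.
    farTrail : ∀ {u z} i j → k ≤ i → Walk u z j → Far o (i + j) z →
      Σ[ z′ ∈ V ] z′ ≈ z × FarTrail k u z′
    farTrail i _ k≤i (nil u≈z) far = _ , u≈z , ε
    farTrail {z = z} i (suc j) k≤i (cons u~v w) far =
      let far′ = subst (λ d → Far o d z) (+-suc i j) far
          z′ , z′≈z , t = farTrail (suc i) j (m≤n⇒m≤1+n k≤i) w far′
      in z′ , z′≈z , (u~v , far-weaken (m≤n⇒m≤1+n k≤i) (far-prefix (suc i) j w far′)) ◅ t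

    -- The walk from `o` to `w` is too short to pass next to `z`, so, starting below `z`, it also
    -- ends below `z`.
    far⇒above : ∀ {w z} → Walk o w n → o ⊑ w → o ⊑ z → Far o (2 + n) z → w ⊑ z × ¬ z ⊑ w
    far⇒above {n} {w} {z} p o⊑w o⊑z far = w⊑z , λ z⊑w →
      notNear (n≤1+n n) (walk-respʳ (⊑.antisym w⊑z z⊑w) p)
      where
      notNear : ∀ {i} → i ≤ suc n → ¬ Walk o z i
      notNear i≤ v = <⇒≱ (s≤s i≤) (far _ v)

      w⊑z : w ⊑ z
      w⊑z with nonadj⇒⊑⊎⊒ (λ w~z → notNear ≤-refl (snoc p w~z)) | nextToWalk p o⊑z
      ... | inj₁ w⊑z | _        = w⊑z
      ... | inj₂ _   | inj₁ w⊑z = w⊑z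
      ... | inj₂ _   | inj₂ (_ , i , j , p₁ , u~z , _ , i+j≡n) =
        contradiction (snoc p₁ u~z) (notNear (s≤s (m+n≤o⇒m≤o i (≤-reflexive i+j≡n))))

    module _ (farAbove : ∀ k → Σ[ z ∈ V ] o ⊑ z × Far o k z) where

      -- A geodesic from `o` to a vertex `z` far above `w` starts below `w` but does not end there,
      -- so it passes next to `w` at some `u`; its remainder leads to the new goal.
      ascend : ∀ k w → o ⊑ w → Far o (suc k) w →
        Σ[ z ∈ V ] Σ[ u ∈ V ] o ⊑ z × Far o (2 + k) z × Adj w u × Far o k u × FarTrail k u z
      ascend k w o⊑w far-w
        with n , p ← walk o w
        -- The summand `2 + n` forces `z` above `w`; the summand `2 + k` makes `z` far enough for
        -- the next ascent.
        with z , o⊑z , far-z ← farAbove (2 + n + (2 + k))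
        with w⊑z , z⋢w ← far⇒above p o⊑w o⊑z (far-weaken (m≤m+n (2 + n) (2 + k)) far-z)
        with m , q , shortest ← least {P = Walk o z} (λ _ → em) (proj₂ (walk o z))
        with nextToWalk q o⊑w
      ... | inj₁ z⊑w = contradiction z⊑w z⋢w
      ... | inj₂ (u , i , j , q₁ , u~w , q₂ , refl) =
        -- As `u` is next to `w`, it is at least `k` steps along the geodesic, so the rest stays at
        -- distance at least `k`.
        let k≤i = s≤s⁻¹ (far-w (suc i) (snoc q₁ u~w))
            z′ , z′≈z , trail = farTrail i j k≤i q₂ shortest
        in z′ , u , ⊑.≤-respʳ-≈ (Eq.sym z′≈z) o⊑z ,
           (λ d v → far-weaken (m≤n+m (2 + k) (2 + n)) far-z d (walk-respʳ z′≈z v)) ,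
           Adj-sym u~w , far-weaken k≤i (far-prefix i j q₂ shortest) , trail

      -- A state of the infinite walk: the current vertex and the trail left to the goal. `phase`
      -- bounds from below the distance to `o`; the goal is two farther, as the ascent to the next
      -- phase requires.
      record Stage : Set (c ⊔ ℓ ⊔ e ⊔ r) where
        constructor stage
        field
          phase     : ℕ
          here goal : V
          o⊑goal    : o ⊑ goal
          far-goal  : Far o (2 + phase) goal
          far-here  : Far o phase here
          trail     : FarTrail phase here goal
      open Stage

      next : Stage → Stage
      -- At the goal the phase rises, and the same step already moves to the neighbour `u`, so that
      -- every step follows an edge.
      next (stage k w _ o⊑w far-w _ ε) =
        let z , u , o⊑z , far-z , _ , far-u , t = ascend (suc k) w o⊑w far-w
        in stage (suc k) u z o⊑z far-z far-u t
      next (stage k _ z o⊑z far-z _ ((_ , far-u) ◅ t)) = stage k _ z o⊑z far-z far-u t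

      next-adj : ∀ s → Adj (here s) (here (next s))
      next-adj (stage k w _ o⊑w far-w _ ε) =
        let _ , _ , _ , _ , w~u , _ = ascend (suc k) w o⊑w far-w in w~u
      next-adj (stage _ _ _ _ _ _ ((w~u , _) ◅ _)) = w~u

      run : Stage → ℕ → Stage
      run s zero    = s
      run s (suc i) = run (next s) i

      run-adj : ∀ s i → Adj (here (run s i)) (here (run s (suc i)))
      run-adj s zero    = next-adj s
      run-adj s (suc i) = run-adj (next s) i

      phase≤next : ∀ s → phase s ≤ phase (next s)
      phase≤next (stage _ _ _ _ _ _ ε)       = n≤1+n _
      phase≤next (stage _ _ _ _ _ _ (_ ◅ _)) = ≤-refl

      phase≤run : ∀ s i → phase s ≤ phase (run s i)
      phase≤run s zero    = ≤-refl
      phase≤run s (suc i) = ≤-trans (phase≤next s) (phase≤run (next s) i)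

      run-+ : ∀ s i j → run s (i + j) ≡ run (run s i) j
      run-+ s zero    j = refl
      run-+ s (suc i) j = run-+ (next s) i j

      run-mono : ∀ s {i j} → i ≤ j → phase (run s i) ≤ phase (run s j)
      run-mono s {i} {j} i≤j = begin
        phase (run s i)                   ≤⟨ phase≤run (run s i) (j ∸ i) ⟩
        phase (run (run s i) (j ∸ i))     ≡⟨ cong phase (run-+ s i (j ∸ i)) ⟨
        phase (run s (i + (j ∸ i)))       ≡⟨ cong (phase ∘ run s) (m+[n∸m]≡n i≤j) ⟩
        phase (run s j)                   ∎
        where open ≤-Reasoning

      -- The trail is finite: once it is used up, one more step raises the phase.
      phase-grows : ∀ s → ∃[ i ] phase s < phase (run s i)
      phase-grows (stage k w z o⊑z far-z far-w t) = go w far-w t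
        where
        go : ∀ w far-w (t : FarTrail k w z) →
             ∃[ i ] k < phase (run (stage k w z o⊑z far-z far-w t) i)
        go w far-w ε                    = 1 , ≤-refl
        go w far-w ((_ , far-u) ◅ t) = let i , k< = go _ far-u t in suc i , k<

      phase-unbounded : ∀ k s → ∃[ i ] k ≤ phase (run s i)
      phase-unbounded zero    s = 0 , z≤n
      phase-unbounded (suc k) s =
        let i , k≤ = phase-unbounded k s
            j , <j = phase-grows (run s i)
        in i + j , ≤-trans (s≤s k≤) (subst (λ s′ → phase (run s i) < phase s′) (sym (run-+ s i j)) <j)

      infiniteInducedPath : ContainsInfiniteInducedPath G
      infiniteInducedPath = locallyFinite⇒inducedPath em (here ∘ run start) (run-adj start) finite
        where
        start : Stage
        start = let z , o⊑z , far-z = farAbove 2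
                in stage 0 z z o⊑z far-z (λ _ _ → z≤n) ε

        finite : ∀ i → ∃[ N ] (∀ j → Adj (here (run start i)) (here (run start j)) → j < N)
        finite i =
          let n , p  = walk o (here (run start i))
              N , <N = phase-unbounded (2 + n) start
          -- From index `N` on, vertices are at distance at least `2 + n` from `o`, while a
          -- neighbour of the vertex at index `i` is at distance at most `1 + n`.
          in N , λ j i~j → ≰⇒> λ N≤j →
               <⇒≱ (≤-trans <N (run-mono start N≤j)) (far-here (run start j) (suc n) (snoc p i~j))

  -- Induced paths in triangle-free incomparability graphs.

  -- By triangle-freeness a neighbour y of z ⊒ x s is comparable to x t or x (t + 1), where t = s - 3,
  -- and lies above it, since otherwise y ⊑ x s ⊑ z; so distances along x shrink at most threefold.
  module IncreasingSequence
    (triangleFree : ∀ {x y z} → Adj x y → Adj z x → ¬ Adj z y)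
    {x : ℕ → V} (x-induced : InducedSequence n x) (x₀⊑x₂ : x 0 ⊑ x 2) where

    private
      x-adj = proj₁ x-induced
      x-apart = proj₂ x-induced

    mutual
      -- The direction set by `x₀⊑x₂` propagates: combined with the preceding relation, a reversed
      -- one would compare two adjacent vertices.
      ⊑-step₂ : ∀ i → 2 + i ≤ n → x i ⊑ x (2 + i)
      ⊑-step₂ zero    _   = x₀⊑x₂
      ⊑-step₂ (suc i) i≤n with nonadj⇒⊑⊎⊒ (proj₂ (x-apart ≤-refl i≤n))
      ... | inj₁ ⊑₂ = ⊑₂
      ... | inj₂ ⊒₂ = contradiction (⊑.trans (⊑-step₃ i i≤n) ⊒₂)
                        (adj⇒⋢ (x-adj (≤-trans (m≤n+m (suc i) 2) i≤n)))

      ⊑-step₃ : ∀ i → 3 + i ≤ n → x i ⊑ x (3 + i)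
      ⊑-step₃ i i≤n with nonadj⇒⊑⊎⊒ (proj₂ (x-apart (n≤1+n (2 + i)) i≤n))
      ... | inj₁ ⊑₃ = ⊑₃
      ... | inj₂ ⊒₃ = contradiction (⊑.trans ⊒₃ (⊑-step₂ i (<⇒≤ i≤n)))
                        (adj⇒⋢ (Adj-sym (x-adj i≤n)))

    ⊑-steps : ∀ d i → 2 + d + i ≤ n → x i ⊑ x (2 + d + i)
    ⊑-steps zero          i i≤n = ⊑-step₂ i i≤n
    ⊑-steps (suc zero)    i i≤n = ⊑-step₃ i i≤n
    ⊑-steps (suc (suc d)) i i≤n =
      ⊑.trans (⊑-steps d i (≤-trans (m≤n+m _ 2) i≤n)) (⊑-step₂ (2 + d + i) i≤n)

    increasing : ∀ {i j} → 2 + i ≤ j → j ≤ n → x i ⊑ x j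
    increasing {i} {j} i≤j j≤n = subst (λ k → x i ⊑ x k) eq
      (⊑-steps (j ∸ (2 + i)) i (≤-trans (≤-reflexive eq) j≤n))
      where
      eq : 2 + (j ∸ (2 + i)) + i ≡ j
      eq = trans (cong (2 +_) (+-comm (j ∸ (2 + i)) i)) (m+[n∸m]≡n i≤j)

    private
      shift : ∀ a t → a + (3 + t) ≡ 3 + a + t
      shift a t = trans (sym (+-assoc a 3 t)) (cong (_+ t) (+-comm a 3))

      ⊑-neighbour : ∀ {u v y} → Adj y u → ¬ Adj y v → v ⊑ u → v ⊑ y
      ⊑-neighbour y~u y≁v v⊑u =
        [ (λ y⊑v → contradiction (⊑.trans y⊑v v⊑u) (adj⇒⋢ y~u)) , id ]′ (nonadj⇒⊑⊎⊒ y≁v)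

    -- Going back along the walk from `z`, each edge costs at most three positions, so `m` edges
    -- still leave position `t`.
    lowerBound : ∀ {y z} → Walk y z m → ∀ t {s} → m * 3 + t ≤ s → s ≤ n → x s ⊑ z →
      ∃[ s′ ] t ≤ s′ × s′ ≤ n × x s′ ⊑ y
    lowerBound (nil y≈z) _ {s} t≤s s≤n xs⊑z = s , t≤s , s≤n , ⊑.≤-respʳ-≈ (Eq.sym y≈z) xs⊑z
    lowerBound {m = suc m} {y} (cons {y = u} y~u w) t t≤s s≤n xs⊑z
      with s′ , 3+t≤s′ , s′≤n , xs′⊑u ←
        lowerBound w (3 + t) (≤-trans (≤-reflexive (shift (m * 3) t)) t≤s) s≤n xs⊑z
      with em {P = Adj y (x t)}
    ... | no y≁xt = t , ≤-refl , ≤-trans (m≤n+m t 3) (≤-trans 3+t≤s′ s′≤n) ,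
      ⊑-neighbour y~u y≁xt (⊑.trans (increasing (<⇒≤ 3+t≤s′) s′≤n) xs′⊑u)
    -- Position `suc t` is still two below `s′`, hence comparable to it; this is why an edge is
    -- charged three positions.
    ... | yes y~xt = suc t , n≤1+n t , 1+t≤n ,
      ⊑-neighbour y~u (triangleFree (x-adj 1+t≤n) y~xt) (⊑.trans (increasing 3+t≤s′ s′≤n) xs′⊑u)
      where
      1+t≤n = ≤-trans (m≤n+m (suc t) 2) (≤-trans 3+t≤s′ s′≤n)

    walk-length : ∀ {s} → s ≤ n → Walk (x 0) (x s) m → s < m * 3 + 2
    walk-length s≤n w = ≰⇒> λ ≤s →
      -- The value 2 is the least index at which `x s′` must lie strictly above `x 0`.
      let s′ , 2≤s′ , s′≤n , xs′⊑x₀ = lowerBound w 2 ≤s s≤n ⊑.refl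
      in proj₁ (x-apart 2≤s′ s′≤n) (⊑.antisym (increasing 2≤s′ s′≤n) xs′⊑x₀)

-- The implications between the four properties.

module _ (G : Graph c ℓ e) where
  open Graph G
  open Walks G

  inducedPath⇒sequence : InducedEmbedding (FinitePath n) G →
    Σ[ x ∈ (ℕ → V) ] InducedSequence n x
  inducedPath⇒sequence {n} π = to ∘ clamp , adjacent , λ i<j j≤n →
      (λ eq → <⇒≢ (<-trans (n<1+n _) i<j) (trans (sym (toℕ-clamp (≤-trans (<⇒≤ (<⇒≤ i<j)) j≤n)))
                 (trans (cong toℕ (injective eq)) (toℕ-clamp j≤n))))
    , λ i~j → apart i<j j≤n (reflects i~j)
    where
    open InducedEmbedding π using (to; injective; preserves; reflects)

    -- Indices beyond `n` are sent to the last vertex as a default.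
    clamp : ℕ → Fin (suc n)
    clamp i = fromℕ< (s≤s (m⊓n≤n i n))

    toℕ-clamp : ∀ {i} → i ≤ n → toℕ (clamp i) ≡ i
    toℕ-clamp i≤n = trans (toℕ-fromℕ< _) (m≤n⇒m⊓n≡m i≤n)

    adjacent : ∀ {i} → suc i ≤ n → Adj (to (clamp i)) (to (clamp (suc i)))
    adjacent {i} i<n = preserves (trans (cong₂ ∣_-_∣ (toℕ-clamp (<⇒≤ i<n)) (toℕ-clamp i<n)) (∣n-1+n∣≡1 i))

    apart : ∀ {i j} → suc i < j → j ≤ n → ¬ ∣ toℕ (clamp i) - toℕ (clamp j) ∣ ≡ 1
    apart {i} {j} i<j j≤n eq
      with ∣m-n∣≡1⇒consecutive i j
             (trans (sym (cong₂ ∣_-_∣ (toℕ-clamp (≤-trans (<⇒≤ (<⇒≤ i<j)) j≤n)) (toℕ-clamp j≤n))) eq)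
    ... | inj₁ refl = <-irrefl refl i<j
    ... | inj₂ refl = <⇒≱ i<j (≤-trans (n≤1+n _) (n≤1+n _))

  infinitePath⇒pathSum : ContainsInfiniteInducedPath G → ContainsSumOfUnboundedPaths G
  infinitePath⇒pathSum π = id , (λ m → m , ≤-refl) , π ∘ᵉ blocks

  pathSum⇒infiniteDetour : ContainsSumOfUnboundedPaths G → InfiniteDetour G
  pathSum⇒infiniteDetour (len , unbounded , π) = unbounded⇒supremum-⊤⁺ λ k →
    let n , k<len = unbounded (suc k)
    in [ len n ] , (len n , refl , π ∘ᵉ summand n) , λ { [ len≤k ] → <⇒≱ k<len len≤k }
    where
    summand : ∀ n → InducedEmbedding (FinitePath (len n)) (⨁ (FinitePath ∘ len))
    summand n = record
      { subgraphEmbedding = record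
        { to        = n ,_
        ; cong      = within
        ; injective = λ { (within eq) → eq }
        ; preserves = within
        }
      ; reflects = λ { (within x~y) → x~y }
      }

module _ (em : ∀ {ℓ} → ExcludedMiddle ℓ) (G : Graph c ℓ e)
         (O : Incomparability G r) (connected : Connected G) where
  open Graph G
  open Walks G
  open Incomparability O

  private
    walk : ∀ x y → ∃[ n ] Walk x y n
    walk x y = map₂ path⇒walk (connected x y)

  infiniteDetour⇒infiniteDiameter : (∀ {x y z} → Adj x y → Adj z x → ¬ Adj z y) →
    InfiniteDetour G → InfiniteDiameter G
  infiniteDetour⇒infiniteDiameter triangleFree detour = unbounded⇒supremum-⊤⁺ unbounded
    where
    unbounded : ∀ k → ∃[ d ] (∃[ x ] ∃[ y ] IsDistance G x y d) × ¬ (d ≤⁺ [ k ])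
    unbounded k
      -- A walk of length at most `k` can only reach positions below `k * 3 + 2`.
      with _ , (n , refl , π) , n≰ ← supremum-⊤⁺⇒unbounded em detour (k * 3 + 2)
      with x , x-induced ← inducedPath⇒sequence G π
      with d , p , d≤ ← least (λ _ → em) (proj₂ (connected (x 0) (x (k * 3 + 2))))
      = [ d ] , (x 0 , x (k * 3 + 2) , p , d≤) , λ { [ d≤k ] →
          <⇒≱ (walk-length (path⇒walk p)) (+-monoˡ-≤ 2 (*-monoˡ-≤ 3 d≤k)) }
      where
      N≤n : k * 3 + 2 ≤ n
      N≤n = ≰⇒≥ λ n≤N → n≰ [ n≤N ]

      walk-length : Walk (x 0) (x (k * 3 + 2)) m → k * 3 + 2 < m * 3 + 2
      walk-length with nonadj⇒⊑⊎⊒ (proj₂ (proj₂ x-induced ≤-refl (≤-trans (m≤n+m 2 (k * 3)) N≤n)))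
      ... | inj₁ x₀⊑x₂ =
        IncomparabilityGraph.IncreasingSequence.walk-length em G O triangleFree x-induced x₀⊑x₂ N≤n
      ... | inj₂ x₂⊑x₀ =
        IncomparabilityGraph.IncreasingSequence.walk-length em G (dual O) triangleFree x-induced x₂⊑x₀ N≤n

  -- If all vertices were within `k` of `o`, any two would be within `k + k` of each other.
  infiniteDiameter⇒far : InfiniteDiameter G → Σ[ o ∈ V ] (∀ k → Σ[ z ∈ V ] Far o k z)
  infiniteDiameter⇒far diameter = o , far
    where
    unbounded = supremum-⊤⁺⇒unbounded em diameter

    o : V
    -- Any vertex serves; this one is an end of some pair at positive distance.
    o = proj₁ (proj₁ (proj₂ (unbounded 0)))

    near : ∀ {k x} → ¬ Far o k x → ∃[ n ] Walk o x n × n ≤ k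
    near ¬far = decidable-stable em λ none → ¬far λ n w → ≰⇒≥ λ n≤k → none (n , w , n≤k)

    distance-bound : ∀ {k x y d} → ¬ Far o k x → ¬ Far o k y → IsDistance G x y d → d ≤⁺ [ k + k ]
    distance-bound {d = ⊤⁺} _ _ noPath =
      contradiction (proj₂ (connected _ _)) (noPath _)
    distance-bound {d = [ d ]} ¬far-x ¬far-y (_ , d≤) =
      let m , v , m≤k = near ¬far-x
          n , w , n≤k = near ¬far-y
          l , u , l≤  = least {P = Walk _ _} (λ _ → em) (reverse v ++ w)
      in [ ≤-trans (d≤ l (shortest⇒path u l≤))
             (≤-trans (l≤ (m + n) (reverse v ++ w)) (+-mono-≤ m≤k n≤k)) ]

    far : ∀ k → Σ[ z ∈ V ] Far o k z
    far k =
      let d , (x , y , xy-dist) , d≰ = unbounded (k + k)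
      in decidable-stable em λ none →
           d≰ (distance-bound (λ far-x → none (x , far-x)) (λ far-y → none (y , far-y)) xy-dist)

  -- Far vertices are comparable to `o`, so unboundedly far ones exist above `o` or below it.
  far⇒infinitePath : ∀ {o} → (∀ k → Σ[ z ∈ V ] Far o k z) → ContainsInfiniteInducedPath G
  far⇒infinitePath {o} far with em {P = ∀ k → Σ[ z ∈ V ] o ⊑ z × Far o k z}
  ... | yes farAbove = IncomparabilityGraph.infiniteInducedPath em G O walk o farAbove
  ... | no ¬farAbove = IncomparabilityGraph.infiniteInducedPath em G (dual O) walk o λ k →
    decidable-stable em λ none → ¬farAbove λ m →
      -- The distance exceeds both `k` and `m`, and the extra 2 excludes adjacency to `o`.
      let z , far-z = far (2 + (k + m))
          o≁z = λ o~z → <⇒≱ (s≤s (s≤s z≤n)) (far-z 1 (cons o~z (nil (Setoid.refl vertices))))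
      in [ (λ o⊑z → z , o⊑z , far-weaken (≤-trans (m≤n+m m k) (m≤n+m _ 2)) far-z)
         , (λ z⊑o → contradiction (z , z⊑o , far-weaken (≤-trans (m≤m+n k m) (m≤n+m _ 2)) far-z) none) ]′
         (nonadj⇒⊑⊎⊒ o≁z)

-- Posets covered by two chains.

module _ (em : ∀ {ℓ} → ExcludedMiddle ℓ) (P : Poset c ℓ₁ ℓ₂) where
  open Poset P using (Carrier; isPartialOrder) renaming (_≤_ to _≼_)

  incomparability : Incomparability (Inc P) ℓ₂
  incomparability = record
    { _⊑_            = _≼_
    ; isPartialOrder = isPartialOrder
    ; adj⇒⋢          = proj₁
    ; nonadj⇒⊑⊎⊒     = λ {x} {y} x≁y → decidable-stable em λ incomparable →
                         x≁y (incomparable ∘ inj₁ , incomparable ∘ inj₂)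
    }

  module _ {A : Pred Carrier a} {B : Pred Carrier b} (chainA : IsChain P A) (chainB : IsChain P B)
           (cover : ∀ x → x ∈ A ⊎ x ∈ B) where

    sameChain : ∀ {C : Pred Carrier p} → IsChain P C → ∀ {x y} → x ∈ C → y ∈ C → ¬ Incomparable P x y
    sameChain chain x∈C y∈C (x⋠y , y⋠x) = [ x⋠y , y⋠x ]′ (chain x∈C y∈C)

    -- Among three vertices, two lie in the same chain.
    Inc-triangleFree : ∀ {x y z} → Incomparable P x y → Incomparable P z x → ¬ Incomparable P z y
    Inc-triangleFree {x} {y} {z} x∥y z∥x z∥y with cover x | cover y | cover z
    ... | inj₁ x∈A | inj₁ y∈A | _        = sameChain chainA x∈A y∈A x∥y
    ... | inj₂ x∈B | inj₂ y∈B | _        = sameChain chainB x∈B y∈B x∥y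
    ... | inj₁ x∈A | inj₂ y∈B | inj₁ z∈A = sameChain chainA z∈A x∈A z∥x
    ... | inj₁ x∈A | inj₂ y∈B | inj₂ z∈B = sameChain chainB z∈B y∈B z∥y
    ... | inj₂ x∈B | inj₁ y∈A | inj₁ z∈A = sameChain chainA z∈A y∈A z∥y
    ... | inj₂ x∈B | inj₁ y∈A | inj₂ z∈B = sameChain chainB z∈B x∈B z∥x

theorem2 : (∀ {ℓ} → ExcludedMiddle ℓ) →
    ∀ {c ℓ₁ ℓ₂ a b : Level} (P : Poset c ℓ₁ ℓ₂)
    (A : Pred (Poset.Carrier P) a) (B : Pred (Poset.Carrier P) b) →
    IsChain P A → IsChain P B → (∀ x → x ∈ A ⊎ x ∈ B) →
    Connected (Inc P) →
    (ContainsSumOfUnboundedPaths (Inc P) ⇔ InfiniteDetour (Inc P)) ×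
    (InfiniteDetour (Inc P) ⇔ InfiniteDiameter (Inc P)) ×
    (InfiniteDiameter (Inc P) ⇔ ContainsInfiniteInducedPath (Inc P))
theorem2 em P A B chainA chainB cover connected =
  mk⇔ i⇒ii (iv⇒i ∘ iii⇒iv ∘ ii⇒iii) ,
  mk⇔ ii⇒iii (i⇒ii ∘ iv⇒i ∘ iii⇒iv) ,
  mk⇔ iii⇒iv (ii⇒iii ∘ i⇒ii ∘ iv⇒i)
  where
  i⇒ii   = pathSum⇒infiniteDetour (Inc P)
  ii⇒iii = infiniteDetour⇒infiniteDiameter em (Inc P) (incomparability em P) connected
             (Inc-triangleFree em P chainA chainB cover)
  iii⇒iv = λ diameter → far⇒infinitePath em (Inc P) (incomparability em P) connected
             (proj₂ (infiniteDiameter⇒far em (Inc P) (incomparability em P) connected diameter))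
  iv⇒i   = infinitePath⇒pathSum (Inc P)
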